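{- For each integer $n\geq 2$, let $G_{2n+1}$ be the graph obtained from the complete graph $K_{2n+1}$ by choosing two vertices $u$ and $v$, subdividing the edge $uv$ with a new vertex $x$ (so the edge $uv$ is replaced by the two edges $ux$ and $xv$), and then attaching $2n-2$ pendant vertices to $x$. Then for every $n\geq 2$, the graph $G_{2n+1}$ is not opposable, and the second player wins SNORT on $G_{2n+1}$.
   Context: All graphs are finite and simple. $N[v]$ denotes the closed neighbourhood of $v$. An opposition of a graph $G$ is an automorphism $f$ of $G$ of order two, in the sense $f\circ f=\mathrm{id}$, such that $f(v)\notin N[v]$ for all $v\in V(G)$. A graph is opposable if it has an opposition. SNORT on a graph $G$: two players, Left and Right, move alternately; all vertices start uncoloured. On her turn Left colours an uncoloured vertex blue that is not adjacent to any red vertex; on his turn Right colours an uncoloured vertex red that is not adjacent to any blue vertex. A player unable to move on their turn loses. "The second player wins SNORT on $G$" means that the player who moves second has a winning strategy (by symmetry this does not depend on whether Left or Right starts). -}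

module Defs where

open import Data.Bool.Base using (if_then_else_)
open import Data.Empty using (⊥)
open import Data.Fin.Base using (Fin)
open import Data.Fin.Properties as Fin using (+↔⊎; 1↔⊤)
open import Data.Maybe.Base using (Maybe; just; nothing)
open import Data.Nat.Base using (ℕ; _+_; _*_; _∸_)
open import Data.Product.Base using (Σ; _×_; _,_)
open import Data.Sum.Base using (_⊎_; inj₁; inj₂; swap)
open import Data.Sum.Function.Propositional using (_⊎-↔_)
open import Data.Unit.Base using (⊤; tt)
open import Function.Bundles using (_↔_; _⇔_; Inverse)
open import Function.Construct.Composition using (_↔-∘_)
open import Function.Construct.Identity using (↔-id)
open import Function.Construct.Symmetry using (↔-sym)
open import Function.Properties.Inverse using (↔⇒↣)
open import Level using (0ℓ)
open import Relation.Binary.Core using (Rel)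
open import Relation.Binary.Definitions using (Decidable; DecidableEquality; Symmetric)
open import Relation.Binary.PropositionalEquality.Core using (_≡_; _≢_; refl; sym)
open import Relation.Nullary.Decidable.Core using (no; does; ¬?; _×-dec_; _⊎-dec_)
open import Relation.Nullary.Decidable using (via-injection)
open import Relation.Nullary.Negation.Core using (¬_)
open import Relation.Unary using (Pred; _∉_)

record Graph : Set₁ where
  infix 4 _~_ _~?_ _≟_
  field
    V      : Set
    order  : ℕ
    finite : V ↔ Fin order
    _~_    : Rel V 0ℓ
    _~?_   : Decidable _~_
    ~-sym  : Symmetric _~_
    ~-irr  : ∀ v → ¬ (v ~ v)

  _≟_ : DecidableEquality V
  _≟_ = via-injection (↔⇒↣ finite) Fin._≟_

  N[_] : V → Pred V 0ℓ
  N[ v ] w = w ≡ v ⊎ v ~ w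

module _ (G : Graph) where
  open Graph G

  record Automorphism : Set where
    field
      perm     : V ↔ V
    open Inverse perm public using (to)
    field
      preserve : ∀ v w → v ~ w ⇔ to v ~ to w

  record IsOpposition (f : Automorphism) : Set where
    open Automorphism f
    field
      involutive : ∀ v → to (to v) ≡ v
      opposed    : ∀ v → to v ∉ N[ v ]

  Opposable : Set
  Opposable = Σ Automorphism IsOpposition

data Player : Set where
  Left Right : Player

opponent : Player → Player
opponent Left  = Right
opponent Right = Left

data Colour : Set where
  blue red : Colour

colourOf : Player → Colour
colourOf Left  = blue
colourOf Right = red

module _ (G : Graph) where
  open Graph G

  -- nothing means uncoloured.
  Position : Set
  Position = V → Maybe Colour

  start : Position
  start _ = nothing

  Legal : Player → Position → V → Set
  Legal p c v = c v ≡ nothing × (∀ w → v ~ w → c w ≢ just (colourOf (opponent p)))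

  play : Player → Position → V → Position
  play p c v w = if does (w ≟ v) then just (colourOf p) else c w

  -- Winning strategies as (well-founded) strategy trees.
  -- WinsMovingNext p c: a winning strategy for p, with p to move at c.
  -- WinsWaiting p c: a winning strategy for p, with p's opponent to move at c;
  -- in particular p has won if the opponent has no legal move.
  data WinsMovingNext (p : Player) (c : Position) : Set
  data WinsWaiting    (p : Player) (c : Position) : Set

  data WinsMovingNext p c where
    move : ∀ v → Legal p c v → WinsWaiting p (play p c v) → WinsMovingNext p c

  data WinsWaiting p c where
    reply : (∀ v → Legal (opponent p) c v →
               WinsMovingNext p (play (opponent p) c v)) →
            WinsWaiting p c

  -- Required for both choices of who is the second player.
  SecondPlayerWinsSnort : Set
  SecondPlayerWinsSnort = ∀ second → WinsWaiting second start

complete : ℕ → Graph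
complete m = record
  { V      = Fin m
  ; order  = m
  ; finite = ↔-id (Fin m)
  ; _~_    = _≢_
  ; _~?_   = λ a b → ¬? (a Fin.≟ b)
  ; ~-sym  = λ a≢b b≡a → a≢b (sym b≡a)
  ; ~-irr  = λ _ a≢a → a≢a refl
  }

-- Subdivision of the edge uv; the new vertex is inj₂ tt.
module _ (G : Graph) (u v : Graph.V G) where
  open Graph G

  SameEdge : Rel V 0ℓ
  SameEdge a b = (a ≡ u × b ≡ v) ⊎ (b ≡ u × a ≡ v)

  SubdivideAdj : Rel (V ⊎ ⊤) 0ℓ
  SubdivideAdj (inj₁ a) (inj₁ b) = a ~ b × ¬ SameEdge a b
  SubdivideAdj (inj₁ a) (inj₂ _) = a ≡ u ⊎ a ≡ v
  SubdivideAdj (inj₂ _) (inj₁ b) = b ≡ u ⊎ b ≡ v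
  SubdivideAdj (inj₂ _) (inj₂ _) = ⊥

  subdivide : u ~ v → Graph
  subdivide _ = record
    { V      = V ⊎ ⊤
    ; order  = order + 1
    ; finite = ↔-sym (+↔⊎ {order} {1}) ↔-∘ (finite ⊎-↔ ↔-sym 1↔⊤)
    ; _~_    = SubdivideAdj
    ; _~?_   = dec
    ; ~-sym  = λ {a} {b} → symm a b
    ; ~-irr  = irr
    }
    where
    dec : Decidable SubdivideAdj
    dec (inj₁ a) (inj₁ b) =
      (a ~? b) ×-dec ¬? (((a ≟ u) ×-dec (b ≟ v)) ⊎-dec ((b ≟ u) ×-dec (a ≟ v)))
    dec (inj₁ a) (inj₂ _) = (a ≟ u) ⊎-dec (a ≟ v)
    dec (inj₂ _) (inj₁ b) = (b ≟ u) ⊎-dec (b ≟ v)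
    dec (inj₂ _) (inj₂ _) = no λ ()

    symm : ∀ a b → SubdivideAdj a b → SubdivideAdj b a
    symm (inj₁ a) (inj₁ b) (a~b , ne) = ~-sym a~b , λ e → ne (swap e)
    symm (inj₁ a) (inj₂ _) e = e
    symm (inj₂ _) (inj₁ b) e = e

    irr : ∀ a → ¬ SubdivideAdj a a
    irr (inj₁ a) (a~a , _) = ~-irr a a~a

-- Attaching k pendant vertices, inj₂ i for i : Fin k, to x.
module _ (G : Graph) (x : Graph.V G) (k : ℕ) where
  open Graph G

  PendantAdj : Rel (V ⊎ Fin k) 0ℓ
  PendantAdj (inj₁ a) (inj₁ b) = a ~ b
  PendantAdj (inj₁ a) (inj₂ _) = a ≡ x
  PendantAdj (inj₂ _) (inj₁ b) = b ≡ x
  PendantAdj (inj₂ _) (inj₂ _) = ⊥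

  attachPendants : Graph
  attachPendants = record
    { V      = V ⊎ Fin k
    ; order  = order + k
    ; finite = ↔-sym (+↔⊎ {order} {k}) ↔-∘ (finite ⊎-↔ ↔-id (Fin k))
    ; _~_    = PendantAdj
    ; _~?_   = dec
    ; ~-sym  = λ {a} {b} → symm a b
    ; ~-irr  = irr
    }
    where
    dec : Decidable PendantAdj
    dec (inj₁ a) (inj₁ b) = a ~? b
    dec (inj₁ a) (inj₂ _) = a ≟ x
    dec (inj₂ _) (inj₁ b) = b ≟ x
    dec (inj₂ _) (inj₂ _) = no λ ()

    symm : ∀ a b → PendantAdj a b → PendantAdj b a
    symm (inj₁ a) (inj₁ b) e = ~-sym e
    symm (inj₁ a) (inj₂ _) e = e
    symm (inj₂ _) (inj₁ b) e = e

    irr : ∀ a → ¬ PendantAdj a a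
    irr (inj₁ a) e = ~-irr a e

-- The graph G₂ₙ₊₁ for the chosen vertices u ≠ v of K₂ₙ₊₁. Adjacency in a
-- complete graph is ≢, so u≢v is the edge uv. The subtraction is exact for n ≥ 1.
G[2_+1] : ∀ n (u v : Fin (2 * n + 1)) → u ≢ v → Graph
G[2 n +1] u v u≢v =
  attachPendants (subdivide (complete (2 * n + 1)) u v u≢v) (inj₂ tt) (2 * n ∸ 2)

{-# OPTIONS --safe #-}

-- Write x for the subdividing vertex and call the vertices of the clique other
-- than u and v inner.
--
-- Not opposable: an opposition sends x outside N[x], so to an inner vertex w, and
-- sends a leaf to a neighbour of w in the clique; such a vertex has a second
-- neighbour, but a leaf has only one.
--
-- SNORT: the second player answers x by an inner vertex and vice versa; each side
-- then has exactly 2n - 2 private moves. The answer to u is v and vice versa,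
-- leaving the 2n - 2 leaves, free for both players. The answer to a leaf is u.
-- Then v is the only move that stops the second player from taking an inner vertex
-- and thereby at least 2n - 2 private moves; after v, an odd number of free
-- leaves remains.
module Submission where

open import Defs
open import Data.Fin.Base using (Fin; zero)
import Data.Fin.Properties as Fin
open import Data.List.Base using (List; []; _∷_; _++_; length; map; allFin)
open import Data.List.Properties using (length-map; length-tabulate)
open import Data.List.Membership.Propositional using (_∈_)
open import Data.List.Membership.Propositional.Properties using (∈-∃++; ∈-++⁻; ∈-map⁺; ∈-map⁻; ∈-allFin)
open import Data.List.Relation.Binary.Permutation.Propositional
  using (_↭_; ↭-refl; ↭-sym; ↭-trans; ↭⇒↭ₛ)
open import Data.List.Relation.Binary.Permutation.Propositional.Properties
  using (shift; ++⁺ˡ; ↭-length; ∈-resp-↭)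
import Data.List.Relation.Binary.Permutation.Setoid.Properties as Permₛ
open import Data.List.Relation.Unary.All as All using (All; []; _∷_)
open import Data.List.Relation.Unary.All.Properties as All using (All¬⇒¬Any)
open import Data.List.Relation.Unary.AllPairs using ([]; _∷_)
open import Data.List.Relation.Unary.Any using (here; there)
open import Data.List.Relation.Unary.Unique.Propositional using (Unique)
import Data.List.Relation.Unary.Unique.Propositional.Properties as Unique
open import Data.Maybe.Base using (just; nothing)
open import Data.Maybe.Properties using (just-injective)
open import Data.Nat.Base using (ℕ; suc; _+_; _*_; _∸_; _≤_; _≥_; s≤s)
open import Data.Nat.Properties using (suc-injective; ≤-reflexive; +-comm; *-comm)
open import Data.Product.Base using (∃-syntax; _×_; _,_; proj₁; proj₂)
open import Data.Sum.Base using (_⊎_; inj₁; inj₂; swap)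
open import Data.Unit.Base using (tt)
open import Function.Base using (_∘_)
open import Function.Bundles using (Equivalence)
open import Relation.Binary.PropositionalEquality.Core using (_≡_; _≢_; refl; sym; trans; cong; subst; ≢-sym)
open import Relation.Binary.PropositionalEquality.Properties using (setoid)
open import Relation.Nullary.Decidable using (yes; no; dec-true; dec-false; _⊎-dec_; Dec)
open import Relation.Nullary.Negation.Core using (¬_; contradiction)

-- For counting the leaves once one is coloured. Writing evenness as `m * 2` rather than `2 * m`
-- lets the successor case compute to two constructors.
pred-even : ∀ m {l} → suc l ≡ m * 2 → ∃[ m′ ] l ≡ suc (m′ * 2)
pred-even (suc m) eq = m , suc-injective eq

-- Lists

module _ {A : Set} where

  Unique-resp-↭ : {xs ys : List A} → xs ↭ ys → Unique xs → Unique ys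
  Unique-resp-↭ xs↭ys = Permₛ.Unique-resp-↭ (setoid A) (↭⇒↭ₛ xs↭ys)

  ∈⇒↭∷ : {x : A} {xs : List A} → x ∈ xs → ∃[ ys ] xs ↭ x ∷ ys
  ∈⇒↭∷ {x} x∈xs with ys , zs , refl ← ∈-∃++ x∈xs = ys ++ zs , shift x ys zs

  -- Used to split the list of all vertices into a few named ones and a remainder that can be
  -- counted. In the induction, `y` must lie in the remainder left by `ys`, since it does not repeat
  -- in `ys`.
  unique⊆⇒↭++ : {xs ys : List A} → Unique ys → All (_∈ xs) ys → ∃[ zs ] xs ↭ ys ++ zs
  unique⊆⇒↭++ {xs} [] [] = xs , ↭-refl
  unique⊆⇒↭++ {ys = y ∷ ys} (y∉ys ∷ ys!) (y∈xs ∷ ys⊆xs)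
    with zs , xs↭ ← unique⊆⇒↭++ ys! ys⊆xs
    with ∈-++⁻ ys (∈-resp-↭ xs↭ y∈xs)
  ... | inj₁ y∈ys = contradiction y∈ys (All¬⇒¬Any y∉ys)
  ... | inj₂ y∈zs with zs′ , zs↭ ← ∈⇒↭∷ y∈zs =
    zs′ , ↭-trans xs↭ (↭-trans (++⁺ˡ ys zs↭) (shift y ys zs′))

-- SNORT on an arbitrary graph

same⊎opponent : ∀ q r → r ≡ q ⊎ r ≡ opponent q
same⊎opponent Left  Left  = inj₁ refl
same⊎opponent Left  Right = inj₂ refl
same⊎opponent Right Left  = inj₂ refl
same⊎opponent Right Right = inj₁ refl

opponent-involutive : ∀ p → opponent (opponent p) ≡ p
opponent-involutive Left  = refl
opponent-involutive Right = refl

colourOf-opponent : ∀ p → colourOf p ≢ colourOf (opponent p)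
colourOf-opponent Left  ()
colourOf-opponent Right ()

module Snort (G : Graph) where
  open Graph G

  private variable
    p q r : Player
    c     : Position G
    v w   : V

  play-self : ∀ r c v → play G r c v v ≡ just (colourOf r)
  play-self r c v rewrite dec-true (v ≟ v) refl = refl

  play-other : ∀ r c w v → w ≢ v → play G r c v w ≡ c w
  play-other r c w v w≢v rewrite dec-false (w ≟ v) w≢v = refl

  -- Vertices are explicit below because, in a concrete graph, Legal and _~_
  -- unfold and unification cannot recover them.
  coloured⇒¬Legal : ∀ v {x} → c v ≡ just x → ¬ Legal G q c v
  coloured⇒¬Legal _ cv≡ (cv≡nothing , _) with () ← trans (sym cv≡) cv≡nothing

  adjacent⇒¬Legal : ∀ v w → v ~ w → c w ≡ just (colourOf q) → ¬ Legal G (opponent q) c v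
  adjacent⇒¬Legal {q = q} _ _ v~w cw≡ (_ , free) =
    free _ v~w (trans cw≡ (cong (just ∘ colourOf) (sym (opponent-involutive q))))

  dominated⇒¬Legal : ∀ w v → w ≡ v ⊎ w ~ v → c v ≡ just (colourOf q) → ¬ Legal G (opponent q) c w
  dominated⇒¬Legal w _ (inj₁ refl) = coloured⇒¬Legal w
  dominated⇒¬Legal w v (inj₂ w~v)  = adjacent⇒¬Legal w v w~v

  start-Legal : ∀ v → Legal G q (start G) v
  start-Legal _ = refl , λ _ _ ()

  -- A move at `v` spoils `w` for `q` only if the two are adjacent and `v` received the hostile
  -- colour; the last hypothesis excludes this combination, either by non-adjacency or by colour.
  play-Legal : Legal G q c w → w ≢ v → (w ~ v → colourOf r ≢ colourOf (opponent q)) →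
               Legal G q (play G r c v) w
  play-Legal {q} {c} {w} {v} {r} (cw≡ , free) w≢v ok = trans (play-other r c w v w≢v) cw≡ , free′
    where
    free′ : ∀ y → w ~ y → play G r c v y ≢ just (colourOf (opponent q))
    free′ y w~y eq with y ≟ v
    ... | yes refl = ok w~y (just-injective (trans (sym (play-self r c v)) eq))
    ... | no y≢v   = free y w~y (trans (sym (play-other r c y v y≢v)) eq)

  play-apart-Legal : ∀ w v → Legal G q c w → w ≢ v → ¬ w ~ v → Legal G q (play G r c v) w
  play-apart-Legal _ _ leg w≢v w≁v = play-Legal leg w≢v λ w~v → contradiction w~v w≁v

  play-own-Legal : ∀ w v → Legal G q c w → w ≢ v → Legal G q (play G q c v) w
  play-own-Legal {q} _ _ leg w≢v = play-Legal leg w≢v λ _ → colourOf-opponent q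

  -- Play only removes legal moves: since `v` was uncoloured, no colour is overwritten and every
  -- earlier obstruction persists.
  play-Legal⁻ : c v ≡ nothing → Legal G q (play G r c v) w → Legal G q c w × w ≢ v
  play-Legal⁻ {c} {v} {q} {r} {w} cv≡ (pw≡ , free) = (trans (sym (play-other r c w v w≢v)) pw≡ , free′) , w≢v
    where
    w≢v : w ≢ v
    w≢v refl with () ← trans (sym (play-self r c v)) pw≡

    free′ : ∀ y → w ~ y → c y ≢ just (colourOf (opponent q))
    free′ y w~y cy≡ with y ≟ v
    ... | yes refl with () ← trans (sym cv≡) cy≡
    ... | no y≢v = free y w~y (trans (play-other r c y v y≢v) cy≡)

  -- A legal move for p that no later move of the opponent can spoil.
  Safe : Player → Position G → V → Set
  Safe p c b = Legal G p c b × (∀ w → N[ b ] w → ¬ Legal G (opponent p) c w)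

  play-own-Safe : Legal G p c v → w ≢ v → Safe p c w → Safe p (play G p c v) w
  play-own-Safe (cv≡ , _) w≢v (leg , blocked) =
    play-own-Legal _ _ leg w≢v , λ y y∈N → blocked y y∈N ∘ proj₁ ∘ play-Legal⁻ cv≡

  -- A vertex that the opponent may colour lies outside the closed neighbourhood of a safe `w`, so
  -- colouring it cannot disturb `w`.
  play-opponent-Safe : Legal G (opponent p) c v → Safe p c w → Safe p (play G (opponent p) c v) w
  play-opponent-Safe leg@(cv≡ , _) (leg′ , blocked) =
    play-apart-Legal _ _ leg′ (λ { refl → blocked _ (inj₁ refl) leg }) (λ w~v → blocked _ (inj₂ w~v) leg) ,
    λ y y∈N → blocked y y∈N ∘ proj₁ ∘ play-Legal⁻ cv≡

  -- Each round costs the opponent at least one entry of `as` and `p` just one of `bs`, so the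
  -- opponent is the first to run out.
  enoughSafe⇒WinsWaiting : ∀ as bs → (∀ w → Legal G (opponent p) c w → w ∈ as) →
                           Unique bs → All (Safe p c) bs → length as ≤ length bs → WinsWaiting G p c
  enoughSafe⇒WinsWaiting {p} {c} as bs legal⊆as bs! safe le = reply λ y leg → respond y leg bs bs! safe le
    where
    respond : ∀ y → Legal G (opponent p) c y → ∀ bs → Unique bs → All (Safe p c) bs → length as ≤ length bs →
              WinsMovingNext G p (play G (opponent p) c y)
    respond y leg bs bs! safe le with as′ , as↭ ← ∈⇒↭∷ (legal⊆as y leg)
      -- The opponent's move shows that `as` is nonempty, so the length bound rules out an empty
      -- `bs` and a reply exists.
      with bs | bs! | safe | subst (_≤ length bs) (↭-length as↭) le
    ... | b ∷ bs | b∉bs ∷ bs! | safe-b ∷ safe-bs | s≤s le′ =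
      move b (proj₁ safe-b′) (enoughSafe⇒WinsWaiting as′ bs legal⊆as′ bs!
        (All.zipWith (λ (b≢b′ , s) → play-own-Safe (proj₁ safe-b′) (≢-sym b≢b′) (play-opponent-Safe leg s))
                     (b∉bs , safe-bs))
        le′)
      where
      safe-b′ = play-opponent-Safe leg safe-b
      legal⊆as′ : ∀ w → Legal G (opponent p) (play G p (play G (opponent p) c y) b) w → w ∈ as′
      legal⊆as′ w leg₂ with leg₁ , _ ← play-Legal⁻ (proj₁ (proj₁ safe-b′)) leg₂
        with leg₀ , w≢y ← play-Legal⁻ (proj₁ leg) leg₁
        with ∈-resp-↭ as↭ (legal⊆as w leg₀)
      ... | here w≡y   = contradiction w≡y w≢y
      ... | there w∈as = w∈as

  -- The player `q` is generalised in each field, so both players have the same moves; by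
  -- independence none spoils another. Only the parity of `vs` then matters.
  record FreeMoves (c : Position G) (vs : List V) : Set where
    field
      unique      : Unique vs
      independent : v ∈ vs → w ∈ vs → ¬ v ~ w
      legal       : v ∈ vs → Legal G q c v
      exhaustive  : Legal G q c v → v ∈ vs

  FreeMoves-resp-↭ : ∀ {vs ws} → vs ↭ ws → FreeMoves c vs → FreeMoves c ws
  FreeMoves-resp-↭ vs↭ws free = record
    { unique      = Unique-resp-↭ vs↭ws unique
    ; independent = λ v∈ w∈ → independent (back v∈) (back w∈)
    ; legal       = legal ∘ back
    ; exhaustive  = ∈-resp-↭ vs↭ws ∘ exhaustive
    }
    where
    open FreeMoves free
    back = λ {v} → ∈-resp-↭ {x = v} (↭-sym vs↭ws)

  play-FreeMoves : ∀ {vs} → FreeMoves c (v ∷ vs) → FreeMoves (play G r c v) vs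
  play-FreeMoves {c} {v} {r} {vs} free with FreeMoves.unique free
  ... | v∉vs ∷ vs! = record
    { unique      = vs!
    ; independent = λ v∈ w∈ → independent (there v∈) (there w∈)
    ; legal       = λ w∈ → play-apart-Legal _ _ (legal (there w∈))
                      (≢-sym (All.lookup v∉vs w∈)) (independent (there w∈) (here refl))
    ; exhaustive  = exhaustive′
    }
    where
    open FreeMoves free
    exhaustive′ : Legal G q (play G r c v) w → w ∈ vs
    exhaustive′ leg with leg₀ , w≢v ← play-Legal⁻ (proj₁ (legal {q = r} (here refl))) leg | exhaustive leg₀
    ... | here w≡v   = contradiction w≡v w≢v
    ... | there w∈vs = w∈vs

  -- Whoever moves uses up exactly one entry of `vs` and leaves the others free, so the two
  -- statements follow by mutual recursion.
  oddFree⇒WinsMovingNext : ∀ m {vs} → length vs ≡ suc (m * 2) → FreeMoves c vs → WinsMovingNext G p c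
  evenFree⇒WinsWaiting   : ∀ m {vs} → length vs ≡ m * 2 → FreeMoves c vs → WinsWaiting G p c

  oddFree⇒WinsMovingNext m {v ∷ vs} len free =
    move v (FreeMoves.legal free (here refl)) (evenFree⇒WinsWaiting m (suc-injective len) (play-FreeMoves free))

  evenFree⇒WinsWaiting m len free = reply λ y leg → respond m len y leg
    where
    respond : ∀ m → _ ≡ m * 2 → ∀ y → Legal G _ _ y → WinsMovingNext G _ (play G _ _ y)
    respond m len y leg with vs′ , vs↭ ← ∈⇒↭∷ (FreeMoves.exhaustive free leg)
      -- An opponent's move needs a nonempty list, so `m` cannot be zero.
      with m | trans (sym (↭-length vs↭)) len
    ... | suc m | len′ = oddFree⇒WinsMovingNext m (suc-injective len′) (play-FreeMoves (FreeMoves-resp-↭ vs↭ free))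

-- The graph, with N clique vertices and k leaves

module SubdividedClique (N k : ℕ) (u v : Fin N) (u≢v : u ≢ v) where

  G : Graph
  G = attachPendants (subdivide (complete N) u v u≢v) (inj₂ tt) k

  open Graph G
  open Snort G

  pattern clique a = inj₁ (inj₁ a)
  pattern hub      = inj₁ (inj₂ tt)
  pattern leaf i   = inj₂ i

  -- `End a` is definitionally adjacency of `clique a` and `hub`, in either order, so proofs of
  -- `End` and `Inner` serve directly as adjacency and non-adjacency to the hub.
  End Inner : Fin N → Set
  End a   = a ≡ u ⊎ a ≡ v
  Inner a = ¬ End a

  end? : ∀ a → Dec (End a)
  end? a = (a Fin.≟ u) ⊎-dec (a Fin.≟ v)

  -- The unordered pair of `a` and `b` is that of `u` and `v`. One argument then covers both choices
  -- of end, and `swap` exchanges them.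
  Ends : Fin N → Fin N → Set
  Ends = SameEdge (complete N) u v

  private variable
    a b w : Fin N
    p q   : Player
    c     : Position G

  clique-injective : _≡_ {A = V} (clique a) (clique b) → a ≡ b
  clique-injective refl = refl

  leaf-injective : ∀ {i j} → _≡_ {A = V} (leaf i) (leaf j) → i ≡ j
  leaf-injective refl = refl

  clique-≢ : a ≢ b → _≢_ {A = V} (clique a) (clique b)
  clique-≢ a≢b = a≢b ∘ clique-injective

  Ends⇒End : Ends a b → End a
  Ends⇒End (inj₁ (a≡u , _)) = inj₁ a≡u
  Ends⇒End (inj₂ (_ , a≡v)) = inj₂ a≡v

  Ends⇒≢ : Ends a b → a ≢ b
  Ends⇒≢ (inj₁ (refl , refl)) = u≢v
  Ends⇒≢ (inj₂ (refl , refl)) = ≢-sym u≢v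

  Ends⇒≁ : Ends a b → ¬ clique a ~ clique b
  Ends⇒≁ ab (_ , ¬ab) = ¬ab ab

  End⇒Ends : End a → ∃[ b ] Ends a b
  End⇒Ends (inj₁ refl) = v , inj₁ (refl , refl)
  End⇒Ends (inj₂ refl) = u , inj₂ (refl , refl)

  End-Ends : Ends a b → End w → w ≡ a ⊎ w ≡ b
  End-Ends (inj₁ (refl , refl)) e = e
  End-Ends (inj₂ (refl , refl)) e = swap e

  Inner⇒~ : Inner w → a ≢ w → clique a ~ clique w
  Inner⇒~ inner a≢w = a≢w , inner ∘ Ends⇒End ∘ swap

  Inner-dominates : Inner w → _≡_ {A = V} (clique a) (clique w) ⊎ clique a ~ clique w
  Inner-dominates {w} {a} inner with a Fin.≟ w
  ... | yes refl = inj₁ refl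
  ... | no a≢w   = inj₂ (Inner⇒~ inner a≢w)

  Inner-End-~ : Inner w → End a → clique w ~ clique a
  Inner-End-~ inner end = (λ { refl → inner end }) , inner ∘ Ends⇒End

  -- Nonexistence of an opposition

  ¬Opposable : Fin k → ¬ Opposable G
  ¬Opposable i (f , opp) = hub-image (to hub) refl
    where
    open Automorphism f
    open IsOpposition opp

    hub-image : ∀ y → to hub ≢ y
    hub-image (clique a) eq with end? a
    ... | yes end  = opposed hub (inj₂ (subst (hub ~_) (sym eq) end))
    ... | no inner = leaf-image (to (leaf i)) refl
      where
      -- The hub is the only neighbour of a leaf, so `to y` is the hub; applying the involution
      -- again turns `y` into the image of the hub.
      leaf-~ : ∀ {y} → leaf i ~ to y → y ≡ clique a
      leaf-~ {y} adj with to y in eq′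
      ... | hub = trans (sym (involutive y)) (trans (cong to eq′) eq)

      -- The involution carries `clique b` back to the leaf, so an edge at `clique b` becomes an
      -- edge at the leaf.
      only-neighbour : ∀ {b y} → to (leaf i) ≡ clique b → clique b ~ y → y ≡ clique a
      only-neighbour {b} {y} eq′ b~y = leaf-~ (subst (_~ to y) (trans (cong to (sym eq′)) (involutive (leaf i)))
        (Equivalence.to (preserve (clique b) y) b~y))

      leaf~image : to (leaf i) ~ clique a
      leaf~image = subst (to (leaf i) ~_) eq (Equivalence.to (preserve (leaf i) hub) refl)

      leaf-image : ∀ y → to (leaf i) ≢ y
      leaf-image (leaf j) eq′ with () ← subst (_~ clique a) eq′ leaf~image
      leaf-image hub eq′ = inner (subst (_~ clique a) eq′ leaf~image)
      leaf-image (clique b) eq′ with end? b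
      -- An end is adjacent to the hub, and an inner vertex to `clique u`; neither of these
      -- neighbours can equal the inner vertex `clique a`.
      ... | yes end with () ← only-neighbour {y = hub} eq′ end
      ... | no b-inner = inner (inj₁ (sym (clique-injective
              (only-neighbour {y = clique u} eq′ (Inner-End-~ b-inner (inj₁ refl))))))
    hub-image hub eq      = opposed hub (inj₁ eq)
    hub-image (leaf j) eq = opposed hub (inj₂ (subst (hub ~_) (sym eq) refl))

  -- The hub and all inner vertices are adjacent to both ends, which now carry different colours, so
  -- they are closed to both players and only uncoloured leaves remain.
  leaves-FreeMoves : ∀ {is} → Ends a b → c (clique a) ≡ just (colourOf q) →
                     c (clique b) ≡ just (colourOf (opponent q)) →
                     Unique is → (∀ {r i} → i ∈ is → Legal G r c (leaf i)) →
                     (∀ {i} → c (leaf i) ≡ nothing → i ∈ is) → FreeMoves c (map leaf is)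
  leaves-FreeMoves {a} {b} {c} {q} {is} ab ca≡ cb≡ is! legal exhaustive = record
    { unique      = Unique.map⁺ leaf-injective is!
    ; independent = independent
    ; legal       = legal′
    ; exhaustive  = exhaustive′
    }
    where
    legal′ : ∀ {r y} → y ∈ map leaf is → Legal G r c y
    legal′ y∈ with _ , i∈ , refl ← ∈-map⁻ leaf y∈ = legal i∈

    independent : ∀ {y z} → y ∈ map leaf is → z ∈ map leaf is → ¬ y ~ z
    independent y∈ z∈ with _ , _ , refl ← ∈-map⁻ leaf y∈ | _ , _ , refl ← ∈-map⁻ leaf z∈ = λ ()

    blocked : ∀ {r} y → y ~ clique a → y ~ clique b → ¬ Legal G r c y
    blocked {r} y y~a y~b leg with same⊎opponent q r
    ... | inj₁ refl = proj₂ leg _ y~b cb≡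
    ... | inj₂ refl = adjacent⇒¬Legal _ _ y~a ca≡ leg

    exhaustive′ : ∀ {r y} → Legal G r c y → y ∈ map leaf is
    exhaustive′ {y = leaf i} leg = ∈-map⁺ leaf (exhaustive (proj₁ leg))
    exhaustive′ {y = hub} leg = contradiction leg (blocked hub (Ends⇒End ab) (Ends⇒End (swap ab)))
    exhaustive′ {y = clique w} leg with end? w
    ... | no inner = contradiction leg
            (blocked (clique w) (Inner-End-~ inner (Ends⇒End ab)) (Inner-End-~ inner (Ends⇒End (swap ab))))
    ... | yes end with End-Ends ab end
    ...   | inj₁ refl = contradiction leg (coloured⇒¬Legal (clique w) ca≡)
    ...   | inj₂ refl = contradiction leg (coloured⇒¬Legal (clique w) cb≡)

  -- The second player's strategy

  module Strategy (N≡3+k : N ≡ 3 + k) (m : ℕ) (k≡2m : k ≡ m * 2) where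

    leaves : List V
    leaves = map leaf (allFin k)

    length-leaves : length leaves ≡ k
    length-leaves = trans (length-map leaf (allFin k)) (length-tabulate _)

    allFin↭ : ∀ {M} {as : List (Fin M)} → Unique as → ∃[ bs ] allFin M ↭ as ++ bs
    allFin↭ as! = unique⊆⇒↭++ as! (All.universal ∈-allFin _)

    Inner-exists : ∃[ w ] Inner w
    Inner-exists with allFin↭ ((u≢v ∷ []) ∷ [] ∷ [])
    -- An empty remainder would give `3 + k ≡ 2`.
    ... | [] , ↭uv with () ← trans (sym N≡3+k) (trans (sym (length-tabulate {n = N} _)) (↭-length ↭uv))
    ... | w ∷ _ , ↭uvw with Unique-resp-↭ ↭uvw (Unique.allFin⁺ N)
    ... | (_ ∷ u≢w ∷ _) ∷ (v≢w ∷ _) ∷ _ = w , λ { (inj₁ refl) → u≢w refl ; (inj₂ refl) → v≢w refl }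

    -- Removing `u`, `v` and `w` from the `3 + k` clique vertices leaves exactly as many as there
    -- are leaves; this equality balances the two sides' private moves.
    record OtherInner (w : Fin N) : Set where
      field
        others     : List (Fin N)
        size       : length others ≡ k
        unique     : Unique others
        sound      : All (λ b → Inner b × b ≢ w) others
        exhaustive : ∀ {b} → Inner b → b ≢ w → b ∈ others

    otherInner : Inner w → OtherInner w
    otherInner {w} inner
      with bs , ↭uvw ← allFin↭ ((u≢v ∷ (λ { refl → inner (inj₁ refl) }) ∷ []) ∷
                                 ((λ { refl → inner (inj₂ refl) }) ∷ []) ∷ [] ∷ [])
      with Unique-resp-↭ ↭uvw (Unique.allFin⁺ N)
    ... | (_ ∷ _ ∷ u∉bs) ∷ (_ ∷ v∉bs) ∷ w∉bs ∷ bs! = record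
      { others     = bs
      ; size       = suc-injective (suc-injective (suc-injective
                     (trans (sym (↭-length ↭uvw)) (trans (length-tabulate _) N≡3+k))))
      ; unique     = bs!
      ; sound      = All.tabulate λ b∈bs →
                     (λ { (inj₁ refl) → All.lookup u∉bs b∈bs refl
                        ; (inj₂ refl) → All.lookup v∉bs b∈bs refl })
                     , ≢-sym (All.lookup w∉bs b∈bs)
      ; exhaustive = exhaustive′
      }
      where
      exhaustive′ : ∀ {b} → Inner b → b ≢ w → b ∈ bs
      exhaustive′ {b} inner b≢w with ∈-resp-↭ ↭uvw (∈-allFin b)
      ... | here b≡u                   = contradiction (inj₁ b≡u) inner
      ... | there (here b≡v)           = contradiction (inj₂ b≡v) inner
      ... | there (there (here b≡w))   = contradiction b≡w b≢w
      ... | there (there (there b∈bs)) = b∈bs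

    -- Holding `w` closes the whole clique to the opponent, who is confined to leaves. The other
    -- inner vertices have all their neighbours in the clique, so they are `k` safe moves for `p`.
    inner⇒WinsWaiting : Inner w → c (clique w) ≡ just (colourOf p) →
                        (∀ {b} → Inner b → b ≢ w → Legal G p c (clique b)) →
                        ¬ Legal G (opponent p) c hub → WinsWaiting G p c
    inner⇒WinsWaiting {w} {c} {p} inner cw≡ legal ¬hub =
      enoughSafe⇒WinsWaiting leaves (map clique others) legal⊆leaves
        (Unique.map⁺ clique-injective unique)
        (All.map⁺ (All.map (λ (b-inner , b≢w) → legal b-inner b≢w , N-blocked b-inner) sound))
        (≤-reflexive (trans length-leaves (trans (sym size) (sym (length-map clique others)))))
      where
      open OtherInner (otherInner inner)

      blocked : ∀ {a} → ¬ Legal G (opponent p) c (clique a)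
      blocked {a} = dominated⇒¬Legal (clique a) (clique w) (Inner-dominates inner) cw≡

      legal⊆leaves : ∀ y → Legal G (opponent p) c y → y ∈ leaves
      legal⊆leaves (clique a) leg = contradiction leg blocked
      legal⊆leaves hub        leg = contradiction leg ¬hub
      legal⊆leaves (leaf i)   _   = ∈-map⁺ leaf (∈-allFin i)

      N-blocked : ∀ {b} → Inner b → ∀ y → N[ clique b ] y → ¬ Legal G (opponent p) c y
      N-blocked b-inner (clique a) _          = blocked
      N-blocked b-inner hub        (inj₂ end) = contradiction end b-inner
      N-blocked b-inner (leaf i)   (inj₂ ())

    after-hub : WinsMovingNext G p (play G (opponent p) (start G) hub)
    after-hub {p} with w , inner ← Inner-exists =
      move (clique w) (legal inner)
        (inner⇒WinsWaiting inner (play-self p c₁ (clique w))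
          (λ {b} b-inner b≢w → play-own-Legal (clique b) (clique w) (legal b-inner) (clique-≢ b≢w))
          (coloured⇒¬Legal hub (trans (play-other p c₁ hub (clique w) λ ()) (play-self (opponent p) (start G) hub))))
      where
      c₁ = play G (opponent p) (start G) hub

      legal : ∀ {b} → Inner b → Legal G p c₁ (clique b)
      legal {b} b-inner = play-apart-Legal (clique b) hub (start-Legal (clique b)) (λ ()) b-inner

    -- The roles are reversed: holding the hub, `p` has the `k` leaves as safe moves, while the
    -- opponent keeps at most the `k` other inner vertices.
    after-inner : Inner w → WinsMovingNext G p (play G (opponent p) (start G) (clique w))
    after-inner {w} {p} inner =
      move hub legal
        (enoughSafe⇒WinsWaiting (map clique others) leaves legal⊆others
          (Unique.map⁺ leaf-injective (Unique.allFin⁺ k))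
          (All.map⁺ (All.universal (λ i → leaf-legal , N-blocked i) (allFin k)))
          (≤-reflexive (trans (length-map _ others) (trans size (sym length-leaves)))))
      where
      open OtherInner (otherInner inner)
      c₁ = play G (opponent p) (start G) (clique w)
      c₂ = play G p c₁ hub

      legal : Legal G p c₁ hub
      legal = play-apart-Legal hub (clique w) (start-Legal hub) (λ ()) inner

      leaf-legal : ∀ {i} → Legal G p c₂ (leaf i)
      leaf-legal {i} = play-own-Legal (leaf i) hub
        (play-apart-Legal (leaf i) (clique w) (start-Legal (leaf i)) (λ ()) (λ ())) (λ ())

      blocked : ∀ y → y ≡ hub ⊎ y ~ hub → ¬ Legal G (opponent p) c₂ y
      blocked y y∈N = dominated⇒¬Legal y hub y∈N (play-self p c₁ hub)

      N-blocked : ∀ i y → N[ leaf i ] y → ¬ Legal G (opponent p) c₂ y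
      N-blocked i _ (inj₁ refl)   = blocked (leaf i) (inj₂ refl)
      N-blocked i hub (inj₂ refl) = blocked hub (inj₁ refl)

      legal⊆others : ∀ y → Legal G (opponent p) c₂ y → y ∈ map clique others
      legal⊆others (leaf i) leg = contradiction leg (blocked (leaf i) (inj₂ refl))
      legal⊆others hub leg      = contradiction leg (blocked hub (inj₁ refl))
      legal⊆others (clique a) leg with end? a
      ... | yes end    = contradiction leg (blocked (clique a) (inj₂ end))
      ... | no a-inner = ∈-map⁺ clique (exhaustive a-inner λ { refl →
              coloured⇒¬Legal (clique a)
                (trans (play-other p c₁ (clique a) hub λ ()) (play-self (opponent p) (start G) (clique w))) leg })

    after-end : End a → WinsMovingNext G p (play G (opponent p) (start G) (clique a))
    after-end {a} {p} end with b , ab ← End⇒Ends end =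
      move (clique b) (play-apart-Legal (clique b) (clique a) (start-Legal (clique b)) (clique-≢ b≢a) (Ends⇒≁ (swap ab)))
        (evenFree⇒WinsWaiting m (trans length-leaves k≡2m)
          (leaves-FreeMoves {q = p} (swap ab) (play-self p c₁ (clique b))
            (trans (play-other p c₁ (clique a) (clique b) (clique-≢ (≢-sym b≢a)))
              (play-self (opponent p) (start G) (clique a)))
            (Unique.allFin⁺ k)
            (λ {_} {i} _ → play-apart-Legal (leaf i) (clique b)
              (play-apart-Legal (leaf i) (clique a) (start-Legal (leaf i)) (λ ()) (λ ())) (λ ()) (λ ()))
            (λ _ → ∈-allFin _)))
      where
      c₁ = play G (opponent p) (start G) (clique a)

      b≢a : b ≢ a
      b≢a = ≢-sym (Ends⇒≢ ab)

    after-leaf : ∀ i → WinsMovingNext G p (play G (opponent p) (start G) (leaf i))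
    -- Colouring `u` closes the hub and the inner vertices to the opponent, who can then choose only
    -- `v` or another leaf.
    after-leaf {p} i = move (clique u) (clique-legal u) (reply respond)
      where
      c₁ = play G (opponent p) (start G) (leaf i)
      c₂ = play G p c₁ (clique u)

      clique-legal : ∀ a → Legal G p c₁ (clique a)
      clique-legal a = play-apart-Legal (clique a) (leaf i) (start-Legal (clique a)) (λ ()) (λ ())

      leaf-legal : ∀ {r j} → i ≢ j → Legal G r (play G (opponent p) c₂ (clique v)) (leaf j)
      leaf-legal {_} {j} i≢j =
        play-apart-Legal (leaf j) (clique v)
          (play-apart-Legal (leaf j) (clique u)
            (play-apart-Legal (leaf j) (leaf i) (start-Legal (leaf j)) (≢-sym i≢j ∘ leaf-injective) (λ ()))
            (λ ()) (λ ()))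
          (λ ()) (λ ())

      u-coloured : c₂ (clique u) ≡ just (colourOf p)
      u-coloured = play-self p c₁ (clique u)

      after-v : WinsMovingNext G p (play G (opponent p) c₂ (clique v))
      -- Without `i` an odd number of leaves is free, and `p` is to move.
      after-v with is , ↭i∷is ← allFin↭ {k} {i ∷ []} ([] ∷ [])
        with Unique-resp-↭ ↭i∷is (Unique.allFin⁺ k)
           | pred-even m (trans (sym (↭-length ↭i∷is)) (trans (length-tabulate _) k≡2m))
      ... | i∉is ∷ is! | m′ , len =
        oddFree⇒WinsMovingNext m′ (trans (length-map leaf is) len)
          (leaves-FreeMoves {q = p} (inj₁ (refl , refl))
            (trans (play-other (opponent p) c₂ (clique u) (clique v) (clique-≢ u≢v)) u-coloured)
            (play-self (opponent p) c₂ (clique v))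
            is! (λ j∈is → leaf-legal (All.lookup i∉is j∈is)) exhaustive)
        where
        exhaustive : ∀ {j} → play G (opponent p) c₂ (clique v) (leaf j) ≡ nothing → j ∈ is
        exhaustive {j} eq with ∈-resp-↭ ↭i∷is (∈-allFin j)
        ... | there j∈is = j∈is
        ... | here refl
          with () ← trans (sym eq) (trans (play-other (opponent p) c₂ (leaf i) (clique v) λ ())
                      (trans (play-other p c₁ (leaf i) (clique u) λ ()) (play-self (opponent p) (start G) (leaf i))))

      respond : ∀ y → Legal G (opponent p) c₂ y → WinsMovingNext G p (play G (opponent p) c₂ y)
      respond hub leg = contradiction leg (adjacent⇒¬Legal hub (clique u) (inj₁ refl) u-coloured)
      respond (clique a) leg with end? a
      ... | yes (inj₁ refl) = contradiction leg (coloured⇒¬Legal (clique u) u-coloured)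
      ... | yes (inj₂ refl) = after-v
      ... | no inner =
        contradiction leg (adjacent⇒¬Legal (clique a) (clique u) (Inner-End-~ inner (inj₁ refl)) u-coloured)
      -- The opponent did not take `v`, so inner vertices are still open to `p`. Bounding the
      -- opponent's moves by all `k` leaves ignores that `i` and `j` are spent, but it suffices.
      respond (leaf j) leg with w , inner ← Inner-exists =
        move (clique w) (legal inner)
          (inner⇒WinsWaiting inner (play-self p c₃ (clique w))
            (λ {b} b-inner b≢w → play-own-Legal (clique b) (clique w) (legal b-inner) (clique-≢ b≢w))
            (adjacent⇒¬Legal hub (clique u) (inj₁ refl)
              (trans (play-other p c₃ (clique u) (clique w) (clique-≢ λ { refl → inner (inj₁ refl) }))
                (trans (play-other (opponent p) c₂ (clique u) (leaf j) λ ()) u-coloured))))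
        where
        c₃ = play G (opponent p) c₂ (leaf j)

        legal : ∀ {b} → Inner b → Legal G p c₃ (clique b)
        legal {b} b-inner = play-apart-Legal (clique b) (leaf j)
          (play-own-Legal (clique b) (clique u) (clique-legal b) (clique-≢ λ { refl → b-inner (inj₁ refl) })) (λ ()) (λ ())

    secondPlayerWins : SecondPlayerWinsSnort G
    secondPlayerWins p = reply λ
      { hub _        → after-hub
      ; (leaf i) _   → after-leaf i
      ; (clique a) _ → after-clique a
      }
      where
      after-clique : ∀ a → WinsMovingNext G p (play G (opponent p) (start G) (clique a))
      after-clique a with end? a
      ... | yes end  = after-end end
      ... | no inner = after-inner inner

mainTheorem5 : ∀ (n : ℕ) → n ≥ 2 → (u v : Fin (2 * n + 1)) (u≢v : u ≢ v) →
    ¬ Opposable (G[2 n +1] u v u≢v) × SecondPlayerWinsSnort (G[2 n +1] u v u≢v)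
mainTheorem5 (suc m) (s≤s (s≤s _)) u v u≢v =
  -- Here `m` is `n - 1`, and `n ≥ 2` makes it a successor, so `m * 2` is positive and `zero` names
  -- a leaf.
  ¬Opposable (subst Fin (sym k≡2m) zero) , Strategy.secondPlayerWins N≡3+k m k≡2m
  where
  open SubdividedClique (2 * suc m + 1) (2 * suc m ∸ 2) u v u≢v

  k≡2m : 2 * suc m ∸ 2 ≡ m * 2
  k≡2m = cong (_∸ 2) (*-comm 2 (suc m))

  N≡3+k : 2 * suc m + 1 ≡ 3 + (2 * suc m ∸ 2)
  N≡3+k = trans (+-comm (2 * suc m) 1) (cong suc (trans (*-comm 2 (suc m)) (cong (2 +_) (sym k≡2m))))
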